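{- For every positive integer $N$, the map $\Phi_N$ is a bijection from $\mathcal{OP}_N$ (the partitions into odd parts at most $2N$) onto $\mathcal{L}_N$ (the lecture hall partitions of width $N$).
   Context: A partition is a finite weakly decreasing sequence $\lambda=(\lambda_1\ge\lambda_2\ge\dots\ge\lambda_\ell>0)$ of positive integers (the empty partition $\emptyset$ is allowed); $\ell(\lambda)=\ell$ is its length. Partitions are identified with sequences obtained by appending zeros. Finitely supported integer sequences are added and subtracted entrywise ($+$, $-$). $\lambda\sqcup\mu$ is the partition whose multiset of parts is the union (multiplicities added) of those of $\lambda$ and $\mu$. Lecture hall partitions. For a positive integer $N$, $\mathcal{L}_N$ is the set of partitions $\mu$ with $\ell(\mu)\le N$ and $$\frac{\mu_1}{N}\ge\frac{\mu_2}{N-1}\ge\dots\ge\frac{\mu_{\ell(\mu)}}{N-\ell(\mu)+1}$$ ($\emptyset\in\mathcal{L}_N$). $\mathcal{OP}_N$ is the set of partitions all of whose parts are odd and at most $2N$ (so parts lie in $\{1,3,\dots,2N-1\}$). Trapezoids. For $n\ge k\ge1$, $[\Diamond]_{n,k}=(n,n-1,\dots,n-2k+2)$ if $k\le n/2$ and $[\Diamond]_{n,k}=(n,n-1,\dots,2k-n-1)$ if $k>n/2$ (a trailing $0$ is dropped); $[\Diamond]_{k-1,k}=\emptyset$. For $i,k\ge1$ put $A_{i,k}=[\Diamond]_{k+i-1,k}-[\Diamond]_{k+i-2,k}$, an integer sequence. The map $\Phi_N$ and the counter $I$. For $\lambda\in\mathcal{OP}_N$ an integer sequence $\Phi_N(\lambda)$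 and a counter $I(\lambda)=[I_1(\lambda),\dots,I_N(\lambda)]$ of nonnegative integers are defined recursively by inserting the parts of $\lambda$ in weakly decreasing order. Start: $\Phi_N(\emptyset)=\emptyset$, $I(\emptyset)=[0,\dots,0]$. Step: if $2k-1$ ($1\le k\le N$) is at most every part of $\lambda$, let $i(\lambda)=\min\{j: I_j(\lambda)=0\}$; then $\Phi_N(\lambda\sqcup(2k-1))=\Phi_N(\lambda)+A_{i(\lambda),k}$, and $I(\lambda\sqcup(2k-1))$ is obtained from $I(\lambda)$ by decreasing each $I_j(\lambda)$ with $j<i(\lambda)$ by $1$, setting the $i(\lambda)$-th entry equal to $N-k-i(\lambda)+1$, and leaving the entries with $j>i(\lambda)$ unchanged. -}

module Defs where

open import Data.Integer as ℤ using (ℤ; +_)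
open import Data.List.Base using (List; []; _∷_; applyUpTo; foldl; length)
open import Data.List.Relation.Unary.All using (All; []; _∷_)
open import Data.List.Relation.Unary.Linked using (Linked; []; [-]; _∷_)
open import Data.Nat
open import Data.Nat.DivMod using (_%_)
open import Data.Nat.Properties
open import Data.Product using (Σ; _×_; _,_; proj₁; proj₂)
open import Data.Rational.Unnormalised as ℚᵘ using (ℚᵘ)
open import Data.Unit using (⊤; tt)
open import Data.Vec.Base using (Vec; []; _∷_; replicate)
open import Relation.Binary.PropositionalEquality
open import Relation.Nullary.Decidable using (yes; no)

record Partition : Set where
  constructor partition
  field
    parts      : List ℕ
    decreasing : Linked _≥_ parts
    positive   : All (_> 0) parts

open Partition public

-- Finitely supported integer sequences; the first entry is the value at 0.
-- Finiteness of the support is not recorded: every sequence below is a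
-- finite combination of padded lists.
Seq : Set
Seq = ℕ → ℤ

infixl 6 _⊕_ _⊖_

_⊕_ _⊖_ : Seq → Seq → Seq
(s ⊕ t) j = s j ℤ.+ t j
(s ⊖ t) j = s j ℤ.- t j

pad : List ℕ → Seq
pad []       _       = + 0
pad (x ∷ xs) zero    = + x
pad (x ∷ xs) (suc j) = pad xs j

-- x₁/N, x₂/(N-1), …, stopping when the denominator would be 0; the truncation
-- is invisible for lists of length at most N.
ratios : ℕ → List ℕ → List ℚᵘ
ratios (suc n) (x ∷ xs) = (+ x ℚᵘ./ suc n) ∷ ratios n xs
ratios _       _        = []

IsLectureHall : ℕ → Partition → Set
IsLectureHall N μ =
  length (parts μ) ≤ N × Linked ℚᵘ._≥_ (ratios N (parts μ))

IsOddPartition : ℕ → Partition → Set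
IsOddPartition N λ′ = All (λ p → p % 2 ≡ 1 × p ≤ 2 * N) (parts λ′)

-- The predicates are propositions, and so are the fields `decreasing` and
-- `positive`; hence _≡_ on these types is equality of the lists of parts.
LH OP : ℕ → Set
LH N = Σ Partition (IsLectureHall N)
OP N = Σ Partition (IsOddPartition N)

-- Meaningful for k ≥ 1 and n ≥ k - 1.  The entries are n, n-1, …, down to
-- n-2k+2 in the first case and to 2k-n-1 in the second; for n = k - 1 the
-- second case gives the empty list.
trapezoid : ℕ → ℕ → List ℕ
trapezoid n k with 2 * k ≤? n
... | yes _ = applyUpTo (n ∸_) (2 * k ∸ 1)
... | no  _ = applyUpTo (n ∸_) (2 * suc n ∸ 2 * k)

A : ℕ → ℕ → Seq
A i k = pad (trapezoid (k + i ∸ 1) k) ⊖ pad (trapezoid (k + i ∸ 2) k)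

-- The 1-based position of the first zero entry; the length plus one if there
-- is none.
firstZero : ∀ {n} → Vec ℕ n → ℕ
firstZero []          = 1
firstZero (zero  ∷ _) = 1
firstZero (suc _ ∷ I) = suc (firstZero I)

-- Decreases by one every entry before the first zero and replaces that zero
-- by v.
advance : ∀ {n} → ℕ → Vec ℕ n → Vec ℕ n
advance v []          = []
advance v (zero  ∷ I) = v ∷ I
advance v (suc m ∷ I) = m ∷ advance v I

-- A part p = 2k - 1 has k = ⌈ p /2⌉.
stepI : ∀ {N} → Vec ℕ N → ℕ → Vec ℕ N
stepI {N} I p = advance (suc N ∸ (⌈ p /2⌉ + firstZero I)) I

insert : ∀ {N} → Seq × Vec ℕ N → ℕ → Seq × Vec ℕ N
insert (s , I) p = s ⊕ A (firstZero I) ⌈ p /2⌉ , stepI I p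

Φ : (N : ℕ) → OP N → Seq
Φ N (λ′ , _) = proj₁ (foldl insert (pad [] , replicate N 0) (parts λ′))

-- On OP N the conventions chosen above to make `firstZero` and `stepI` total
-- play no role: at each insertion k + i ≤ N + 1, so a zero entry exists and
-- the new entry N - k - i + 1 is not truncated.
WellDefined : ∀ {N} → Vec ℕ N → List ℕ → Set
WellDefined     I []       = ⊤
WellDefined {N} I (p ∷ ps) =
  ⌈ p /2⌉ + firstZero I ≤ suc N × WellDefined (stepI I p) ps

private
  Bounded : ∀ {n} → ℕ → Vec ℕ n → Set
  Bounded b []      = ⊤
  Bounded b (x ∷ I) = x ≤ b × Bounded (pred b) I

  bounded-mono : ∀ {n b c} (I : Vec ℕ n) → b ≤ c → Bounded b I → Bounded c I
  bounded-mono []      _   _       = tt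
  bounded-mono (x ∷ I) b≤c (h , t) =
    ≤-trans h b≤c , bounded-mono I (pred-mono-≤ b≤c) t

  bounded-0 : ∀ n {b} → Bounded b (replicate n 0)
  bounded-0 zero    = tt
  bounded-0 (suc n) = z≤n , bounded-0 n

  firstZero-≤ : ∀ {n b} (I : Vec ℕ n) → b < n → Bounded b I →
                firstZero I ≤ suc b
  firstZero-≤ (zero  ∷ I) _         _             = s≤s z≤n
  firstZero-≤ (suc _ ∷ I) (s≤s b<n) (s≤s _ , t) = s≤s (firstZero-≤ I b<n t)

  bounded-advance : ∀ {n b} (I : Vec ℕ n) → Bounded b I →
                    Bounded b (advance (suc b ∸ firstZero I) I)
  bounded-advance []          _             = tt
  bounded-advance (zero  ∷ I) (_ , t)       = ≤-refl , t
  bounded-advance (suc _ ∷ I) (s≤s m≤b , t) =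
    m≤n⇒m≤1+n m≤b , bounded-advance I t

  wellDefined-from : ∀ {N} (I : Vec ℕ N) p ps → Linked _≥_ (p ∷ ps) →
    All (_> 0) (p ∷ ps) → All (λ q → q % 2 ≡ 1 × q ≤ 2 * N) (p ∷ ps) →
    Bounded (N ∸ ⌈ p /2⌉) I → WellDefined I (p ∷ ps)
  wellDefined-from {N} I p@(suc _) ps dec (_ ∷ pos) ((_ , p≤2N) ∷ odd) bnd =
    k+i≤1+N , rest ps dec pos odd
    where
    k = ⌈ p /2⌉

    k≤N : k ≤ N
    k≤N = subst (k ≤_)
      (trans (cong (λ m → ⌈ N + m /2⌉) (+-identityʳ N)) (sym (n≡⌈n+n/2⌉ N)))
      (⌈n/2⌉-mono p≤2N)

    N∸k<N : N ∸ k < N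
    N∸k<N = ∸-monoʳ-< {n = k} {o = 0} (⌈n/2⌉-mono {1} {p} (s≤s z≤n)) k≤N

    k+i≤1+N : k + firstZero I ≤ suc N
    k+i≤1+N = ≤-trans (+-monoʳ-≤ k (firstZero-≤ I N∸k<N bnd))
      (≤-reflexive (trans (+-suc k (N ∸ k)) (cong suc (m+[n∸m]≡n k≤N))))

    bnd′ : Bounded (N ∸ k) (stepI I p)
    bnd′ = subst (λ v → Bounded (N ∸ k) (advance v I))
      (trans (cong (_∸ firstZero I) (sym (+-∸-assoc 1 k≤N)))
             (∸-+-assoc (suc N) k (firstZero I)))
      (bounded-advance I bnd)

    rest : ∀ qs → Linked _≥_ (p ∷ qs) → All (_> 0) qs →
           All (λ q → q % 2 ≡ 1 × q ≤ 2 * N) qs → WellDefined (stepI I p) qs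
    rest []       _            _   _   = tt
    rest (q ∷ qs) (p≥q ∷ dec′) pos′ odd′ =
      wellDefined-from (stepI I p) q qs dec′ pos′ odd′
        (bounded-mono (stepI I p) (∸-monoʳ-≤ N (⌈n/2⌉-mono p≥q)) bnd′)

wellDefined : ∀ N (λ′ : OP N) → WellDefined (replicate N 0) (parts (proj₁ λ′))
wellDefined N (partition []       _   _   , _  ) = tt
wellDefined N (partition (p ∷ ps) dec pos , odd) =
  wellDefined-from (replicate N 0) p ps dec pos odd (bounded-0 N)

module Submission where

-- Write a part 2k-1 as k and read the parts of λ from the largest down.  Entry
-- I₁ of the counter splits them: when I₁ = 0 the next k is selected (i = 1) and
-- the N - k parts after it are skipped (i > 1).  Since A 1 k = (k, k-1) and
-- A i k = (1, 1) followed by A (i-1) (k-1), the first two rows of Φ_N(λ) are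
-- read off the selection, and the rows below are Φ_{N-2} of the skipped parts,
-- each k lowered by one.
--
-- The passage N → N - 2 is a composition of two passages n + 1 → n.  For a list
-- w of numbers in [1,n] let `total n w` be the sum of its selected entries plus
-- the number of its skipped ones.  The first two rows are total N w and
-- total (N-1) (lower w), where lower subtracts one everywhere and drops zeros.
-- Both w ↦ lower w and w ↦ skipped (n+1) w have the property that w is
-- determined by its image v and by x = total (n+1) w, and that the pairs (v , x)
-- which occur are those with x/(n+1) ≥ (total n v)/n: the lecture hall condition.
--
-- For `skipped` write total n w = n s - c, with s selected entries and c the
-- number of further skips the last one still allows.  Given v, s and c, the
-- list w is rebuilt from its smallest entry: with current slack c, the next
-- entry e of v comes next if e + c < n, and otherwise n - c has to be selected.

open import Defs
open import Data.Bool.Base using (Bool; true; false; not)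
open import Data.Integer as ℤ using (ℤ; +_)
import Data.Integer.Properties as ℤ
open import Data.List.Base using (List; []; _∷_; _++_; map; replicate; length; reverse; _ʳ++_; foldl; foldr; applyUpTo)
open import Data.List.Properties using (reverse-map; reverse-involutive; reverse-injective; reverse-foldr; map-∘; map-id-local; ∷-injectiveˡ; ∷-injectiveʳ)
open import Data.List.Relation.Unary.All as All using (All; []; _∷_)
open import Data.List.Relation.Unary.All.Properties using (map⁺)
open import Data.List.Relation.Unary.Linked as Linked using (Linked; []; [-]; _∷_)
open import Data.Nat
open import Data.Nat.DivMod using (_%_)
open import Data.Nat.Properties
open import Data.Nat.Tactic.RingSolver using (solve-∀)
open import Data.Product using (Σ-syntax; ∃-syntax; _×_; _,_; proj₁; proj₂)
open import Data.Rational.Unnormalised as ℚᵘ using (*≤*)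
import Data.Rational.Unnormalised.Properties as ℚᵘ
open import Data.Sum using (_⊎_; inj₁; inj₂)
open import Data.Vec.Base as Vec using (Vec; []; _∷_; head; tail)
open import Function.Bundles using (_⤖_; mk⤖; module Bijection)
open import Relation.Binary.Definitions using (tri<; tri≈; tri>)
open import Relation.Binary.PropositionalEquality
open import Relation.Nullary using (yes; no; contradiction)

-- Selected and skipped parts

data Ascending (n : ℕ) : List ℕ → Set where
  []   : Ascending n []
  cons : ∀ {e w} → 0 < e → e ≤ n → All (e ≤_) w → Ascending n w →
         Ascending n (e ∷ w)

ascending-all : ∀ {n w} {P : ℕ → Set} → (∀ {e} → 0 < e → e ≤ n → P e) →
                Ascending n w → All P w
ascending-all f []                 = []
ascending-all f (cons 0<e e≤n _ a) = f 0<e e≤n ∷ ascending-all f a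

-- Lists are ascending and processed from the far end, so the head is the entry
-- handled last.  In Run n w v c s x: v are the skipped entries of w, s counts
-- the selected ones, c is the slack left at the end and x is the total.
data Run (n : ℕ) : (w v : List ℕ) (c s x : ℕ) → Set where
  []     : Run n [] [] 0 0 0
  select : ∀ {c e w v s x} → c + e ≡ n → Run n w v 0 s x →
           Run n (e ∷ w) v c (suc s) (e + x)
  skip   : ∀ {c e w v s x} → Run n w v (suc c) s x →
           Run n (e ∷ w) (e ∷ v) c s (suc x)

slack : ℕ → List ℕ → ℕ
slack n []      = 0
slack n (e ∷ w) with slack n w
... | zero  = n ∸ e
... | suc c = c

skipped : ℕ → List ℕ → List ℕ
skipped n []      = []
skipped n (e ∷ w) with slack n w
... | zero  = skipped n w
... | suc _ = e ∷ skipped n w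

total : ℕ → List ℕ → ℕ
total n []      = 0
total n (e ∷ w) with slack n w
... | zero  = e + total n w
... | suc _ = suc (total n w)

run : ∀ {n w} → Ascending n w →
      ∃[ s ] Run n w (skipped n w) (slack n w) s (total n w)
run []                      = 0 , []
run {n} (cons {w = w} _ e≤n _ asc) with slack n w | run asc
... | zero  | s , r = suc s , select (m∸n+n≡m e≤n) r
... | suc _ | s , r = s , skip r

run-slack : ∀ {n w v c s x} → Run n w v c s x → slack n w ≡ c
run-slack []                         = refl
run-slack {n} (select {c} {e} c+e≡n r) rewrite run-slack r =
  trans (cong (_∸ e) (sym c+e≡n)) (m+n∸n≡m c e)
run-slack (skip r) rewrite run-slack r = refl

run-skipped : ∀ {n w v c s x} → Run n w v c s x → skipped n w ≡ v
run-skipped []                                         = refl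
run-skipped (select _ r) rewrite run-slack r           = run-skipped r
run-skipped (skip {e = e} r) rewrite run-slack r       = cong (e ∷_) (run-skipped r)

run-total : ∀ {n w v c s x} → Run n w v c s x → total n w ≡ x
run-total []                                         = refl
run-total (select {e = e} _ r) rewrite run-slack r   = cong (λ y → e + y) (run-total r)
run-total (skip r) rewrite run-slack r               = cong suc (run-total r)

-- A selected `e` adds `e` to the total and resets the slack from 0 to `n - e`; a skipped entry
-- moves one unit from the slack to the total.
total+slack : ∀ {n w v c s x} → Run n w v c s x → x + c ≡ n * s
total+slack {n} [] = sym (*-zeroʳ n)
total+slack {n} (select {c} {e} {s = s} {x = x} c+e≡n r) = begin
  e + x + c          ≡⟨ lemma e x c ⟩
  c + e + (x + 0)    ≡⟨ cong₂ _+_ c+e≡n (total+slack r) ⟩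
  n + n * s          ≡⟨ *-suc n s ⟨
  n * suc s          ∎
  where
  open ≡-Reasoning
  lemma : ∀ e x c → e + x + c ≡ c + e + (x + 0)
  lemma = solve-∀
total+slack (skip {c} {x = x} r) = trans (sym (+-suc x c)) (total+slack r)

-- The most recently selected entry is at least `e`, so it left slack at most `n - e`, and skips
-- only use slack up.
slack-bound : ∀ {n w v c s x e} → All (e ≤_) w → Run n w v (suc c) s x →
              suc c + e ≤ n
slack-bound {c = c} (e≤ ∷ _) (select eq r) =
  subst (_ ≤_) eq (+-monoʳ-≤ (suc c) e≤)
slack-bound (_ ∷ e≤w) (skip r) = <⇒≤ (slack-bound e≤w r)

slack<width : ∀ {n w v c s x} → Ascending n w → Run n w v c (suc s) x → c < n
slack<width {c = c} (cons 0<e _ _ _) (select eq r) =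
  subst (c <_) eq (m<m+n c 0<e)
slack<width (cons _ _ _ asc) (skip r) = <⇒≤ (slack<width asc r)

-- The slack starts at 0, so no entry can be skipped before the first selection.
none-selected : ∀ {n w v c x} → Run n w v c 0 x → c ≡ 0 × x ≡ 0
none-selected []       = refl , refl
none-selected (skip r) with () ← proj₁ (none-selected r)

run-all : ∀ {n w v c s x} {P : ℕ → Set} → Run n w v c s x → All P w → All P v
run-all []           _          = []
run-all (select _ r) (_ ∷ ps)   = run-all r ps
run-all (skip r)     (p ∷ ps)   = p ∷ run-all r ps

-- This makes the last step of a run recoverable: a selected smallest entry has `e ≤ f`, whereas
-- skipping `f` with slack `c` left forces `c + f < n`.
select≢skip : ∀ {n e f w w′ v c s s′ x x′} → All (e ≤_) w → All (f ≤_) w′ →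
  Run n w (f ∷ v) 0 s x → Run n w′ v (suc c) s′ x′ → c + e ≢ n
select≢skip {c = c} e≤ f≤ r r′ p with e≤f ∷ _ ← run-all r e≤ =
  <-irrefl p (≤-<-trans (+-monoʳ-≤ c e≤f) (slack-bound f≤ r′))

run-unique : ∀ {n w w′ v c s x x′} → Ascending n w → Ascending n w′ →
             Run n w v c s x → Run n w′ v c s x′ → w ≡ w′
run-unique _ _ [] [] = refl
run-unique (cons _ _ _ a) (cons _ _ _ a′) (select {c} p r) (select q r′) =
  cong₂ _∷_ (+-cancelˡ-≡ c _ _ (trans p (sym q))) (run-unique a a′ r r′)
run-unique (cons _ _ _ a) (cons _ _ _ a′) (skip r) (skip r′) =
  cong (_ ∷_) (run-unique a a′ r r′)
run-unique (cons _ _ e≤ _) (cons _ _ f≤ _) (select p r) (skip r′) =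
  contradiction p (select≢skip e≤ f≤ r r′)
run-unique (cons _ _ f≤ _) (cons _ _ e≤ _) (skip r′) (select p r) =
  contradiction p (select≢skip e≤ f≤ r r′)

-- This is x/(m+1) ≥ x′/m for x = (m+1) s - c and x′ = m s′ - c′ with slacks in
-- range; see dominated⇒≤ and ≤⇒dominated.
Dominated : (s′ c′ s c : ℕ) → Set
Dominated s′ c′ s c = s′ < s ⊎ (s′ ≡ s × c ≤ c′)

-- The two runs are followed in lockstep; an entry selected at width `m + 1` never reaches the run
-- at width `m`, which therefore cannot get ahead.
skipped-dominated : ∀ {m w v u c s x c′ s′ x′} → Ascending (suc m) w →
  Run (suc m) w v c s x → Run m v u c′ s′ x′ → Dominated s′ c′ s c
skipped-dominated _ [] [] = inj₂ (refl , z≤n)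
skipped-dominated (cons _ _ _ a) (select _ r) r′ with skipped-dominated a r r′
... | inj₁ lt         = inj₁ (m≤n⇒m≤1+n lt)
... | inj₂ (refl , _) = inj₁ ≤-refl
skipped-dominated (cons _ _ e≤ a) (skip {c} {e} r) (select {c′} eq r′)
  with skipped-dominated a r r′
-- A tie beforehand is impossible: the inner slack was 0 and the outer one positive. If this
-- selection creates a tie, `slack-bound` compares the slacks.
... | inj₁ lt with m≤n⇒m<n∨m≡n lt
...   | inj₁ lt′ = inj₁ lt′
...   | inj₂ eq′ = inj₂ (eq′ , +-cancelʳ-≤ e c c′
        (subst (c + e ≤_) (sym eq) (s≤s⁻¹ (slack-bound e≤ r))))
skipped-dominated (cons _ _ _ a) (skip r) (skip r′) with skipped-dominated a r r′
... | inj₁ lt               = inj₁ lt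
... | inj₂ (refl , s≤s c≤c′) = inj₂ (refl , c≤c′)

-- The head of `w` is its minimum. If selected, it equals `n - c`; if skipped, it occurs in `v`.
all-≤ : ∀ {n w v c s x e} → Ascending n w → c + e ≤ n → All (e ≤_) v →
        Run n w v c s x → All (e ≤_) w
all-≤ _ _ _ [] = []
all-≤ {c = c} {e = e} (cons _ _ f≤ _) c+e≤n _ (select {e = f} eq r) =
  e≤f ∷ All.map (≤-trans e≤f) f≤
  where
  e≤f : e ≤ f
  e≤f = +-cancelˡ-≤ c e f (subst (_ ≤_) (sym eq) c+e≤n)
all-≤ (cons _ _ f≤ _) _ (e≤f ∷ _) (skip r) = e≤f ∷ All.map (≤-trans e≤f) f≤

all-selected : ∀ m s → ∃[ w ] ∃[ x ] Ascending (suc m) w × Run (suc m) w [] 0 s x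
all-selected m zero    = [] , 0 , [] , []
all-selected m (suc s) with all-selected m s
... | w , x , a , r = suc m ∷ w , suc m + x
    , cons z<s ≤-refl (all-≤ a ≤-refl [] r) a , select refl r

select-first : ∀ {m w v s x c} → c ≤ m → All (suc m ∸ c ≤_) v → Ascending (suc m) w →
  Run (suc m) w v 0 s x →
  ∃[ w′ ] ∃[ x′ ] Ascending (suc m) w′ × Run (suc m) w′ v c (suc s) x′
select-first {m} {w} {x = x} {c} c≤m t≤v a r = suc m ∸ c ∷ w , suc m ∸ c + x
  , cons (m<n⇒0<n∸m (s≤s c≤m)) (m∸n≤m (suc m) c) (all-≤ a (m∸n≤m (suc m) c) t≤v r) a
  , select (m+[n∸m]≡n (m≤n⇒m≤1+n c≤m)) r

skip-first : ∀ {m e w v c s x} → 0 < e → c + e ≤ m → All (e ≤_) v →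
  Ascending (suc m) w → Run (suc m) w v (suc c) s x →
  ∃[ w′ ] ∃[ x′ ] Ascending (suc m) w′ × Run (suc m) w′ (e ∷ v) c s x′
skip-first {e = e} {w} {c = c} {x = x} 0<e c+e≤m e≤v a r = e ∷ w , suc x
  , cons 0<e (≤-trans (m≤n+m e c) (m≤n⇒m≤1+n c+e≤m)) (all-≤ a (s≤s c+e≤m) e≤v r) a , skip r

-- Induction on `v`: the last step of the wanted run is forced by `c` and `e`, and domination passes
-- to the state before `e`.
dominated⇒run : ∀ {m v u c′ s′ x′ c s} → Ascending m v → Run m v u c′ s′ x′ → c ≤ m →
  Dominated s′ c′ s c →
  ∃[ w ] ∃[ x ] Ascending (suc m) w × Run (suc m) w v c s x
dominated⇒run [] [] c≤m (inj₂ (refl , z≤n)) = [] , 0 , [] , []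
dominated⇒run {m} {s = suc s} [] [] c≤m (inj₁ _) with all-selected m s
... | w , x , a , r = select-first c≤m [] a r
dominated⇒run {m} {v = e ∷ v} {c = c} (cons 0<e e≤m e≤v asc) r c≤m d with c + e ≤? m
-- A selected last entry would be `m + 1 - c`, larger than `e` and hence not the smallest. So `e` is
-- skipped last, from slack `c + 1`.
... | yes c+e≤m = let _ , _ , a , r′ = go r d in skip-first 0<e c+e≤m e≤v a r′
  where
  c<m : suc c ≤ m
  c<m = ≤-trans (m<m+n c 0<e) c+e≤m
  go : ∀ {u c′ s′ x′ s} → Run m (e ∷ v) u c′ s′ x′ → Dominated s′ c′ s c →
       ∃[ w ] ∃[ x ] Ascending (suc m) w × Run (suc m) w v (suc c) s x
  go (select _ r) (inj₁ lt)           = dominated⇒run asc r c<m (inj₁ (<⇒≤ lt))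
  go (select _ r) (inj₂ (refl , _))   = dominated⇒run asc r c<m (inj₁ ≤-refl)
  go (skip r)     (inj₁ lt)           = dominated⇒run asc r c<m (inj₁ lt)
  go (skip r)     (inj₂ (refl , c≤))  = dominated⇒run asc r c<m (inj₂ (refl , s≤s c≤))
-- By `slack-bound` the last step cannot skip `e`, so it selects `m + 1 - c`. The slack before it is
-- 0, and there `e` can be skipped, from slack 1.
... | no c+e≰m = go r d
  where
  m<c+e : m < c + e
  m<c+e = ≰⇒> c+e≰m
  t≤e : suc m ∸ c ≤ e
  t≤e = m≤n+o⇒m∸n≤o (suc m) c m<c+e
  finish : ∀ {s} → (∃[ w ] ∃[ x ] Ascending (suc m) w × Run (suc m) w v 1 s x) →
       ∃[ w ] ∃[ x ] Ascending (suc m) w × Run (suc m) w (e ∷ v) c (suc s) x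
  finish (_ , _ , a , r) =
    let _ , _ , a′ , r′ = skip-first 0<e e≤m e≤v a r
    in select-first c≤m (t≤e ∷ All.map (≤-trans t≤e) e≤v) a′ r′
  1≤m : 1 ≤ m
  1≤m = ≤-trans 0<e e≤m
  go : ∀ {u c′ s′ x′ s} → Run m (e ∷ v) u c′ s′ x′ → Dominated s′ c′ s c →
       ∃[ w ] ∃[ x ] Ascending (suc m) w × Run (suc m) w (e ∷ v) c s x
  go (select _ r) (inj₁ (s≤s lt)) = finish (dominated⇒run asc r 1≤m (inj₁ lt))
  go (select eq r) (inj₂ (refl , c≤)) =
    contradiction (≤-trans (+-monoˡ-≤ e c≤) (≤-reflexive eq)) c+e≰m
  go (skip r) (inj₁ (s≤s le)) with m≤n⇒m<n∨m≡n le
  ... | inj₁ lt   = finish (dominated⇒run asc r 1≤m (inj₁ lt))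
  ... | inj₂ refl = finish (dominated⇒run asc r 1≤m (inj₂ (refl , s≤s z≤n)))
  go (skip r) (inj₂ (refl , c≤)) =
    contradiction (≤-trans (+-monoˡ-≤ e (m≤n⇒m≤1+n c≤)) (slack-bound e≤v r)) c+e≰m

-- The two passages from width n + 1 to width n

swap-product : ∀ m s → suc m * (m * s) ≡ m * (suc m * s)
swap-product = solve-∀

-- Adding `m * c` to both sides turns `m * x` into `m * (suc m * s)`. A deficit in `s′` outweighs
-- any `c ≤ m`; for equal counts it suffices that `m * c ≤ suc m * c′`.
dominated⇒≤ : ∀ {m c s x c′ s′ x′} → x + c ≡ suc m * s → x′ + c′ ≡ m * s′ →
  c ≤ m → Dominated s′ c′ s c → suc m * x′ ≤ m * x
dominated⇒≤ {m} {c} {s} {x} {c′} {s′} {x′} eq eq′ c≤m d =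
  +-cancelʳ-≤ (m * c) _ _ (begin
    suc m * x′ + m * c   ≤⟨ go d ⟩
    m * (suc m * s)      ≡⟨ cong (m *_) eq ⟨
    m * (x + c)          ≡⟨ *-distribˡ-+ m x c ⟩
    m * x + m * c        ∎)
  where
  open ≤-Reasoning
  factor : ∀ m s → suc m * (m * s) + m * suc m ≡ m * (suc m * suc s)
  factor = solve-∀
  go : Dominated s′ c′ s c → suc m * x′ + m * c ≤ m * (suc m * s)
  go (inj₁ s′<s) = begin
    suc m * x′ + m * c               ≤⟨ +-mono-≤
      (*-monoʳ-≤ (suc m) (≤-trans (m≤m+n x′ c′) (≤-reflexive eq′)))
      (*-monoʳ-≤ m (m≤n⇒m≤1+n c≤m)) ⟩
    suc m * (m * s′) + m * suc m     ≡⟨ factor m s′ ⟩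
    m * (suc m * suc s′)             ≤⟨ *-monoʳ-≤ m (*-monoʳ-≤ (suc m) s′<s) ⟩
    m * (suc m * s)                  ∎
  go (inj₂ (refl , c≤c′)) = begin
    suc m * x′ + m * c         ≤⟨ +-monoʳ-≤ (suc m * x′) (*-mono-≤ (n≤1+n m) c≤c′) ⟩
    suc m * x′ + suc m * c′    ≡⟨ *-distribˡ-+ (suc m) x′ c′ ⟨
    suc m * (x′ + c′)          ≡⟨ cong (suc m *_) eq′ ⟩
    suc m * (m * s)            ≡⟨ swap-product m s ⟩
    m * (suc m * s)            ∎

-- For `s = s′` the inequality reads `m * c ≤ suc m * c′`, which with `c ≤ m` forces `c ≤ c′`. For
-- `s < s′` it would give `m ≤ c′`.
≤⇒dominated : ∀ {m c s x c′ s′ x′} → x + c ≡ suc m * s → x′ + c′ ≡ m * s′ →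
  c ≤ m → (s < s′ → c′ < m) → suc m * x′ ≤ m * x → Dominated s′ c′ s c
≤⇒dominated {m} {c} {s} {x} {c′} {s′} {x′} eq eq′ c≤m c′<m le with <-cmp s′ s
... | tri< s′<s _ _ = inj₁ s′<s
... | tri≈ _ refl _ = inj₂ (refl , ≮⇒≥ c′≮c)
  where
  open ≤-Reasoning
  c′≮c : c′ < c → _
  c′≮c c′<c = <-irrefl refl (begin-strict
    m * c           ≤⟨ +-cancelˡ-≤ (m * x) _ _ (begin
      m * x + m * c            ≡⟨ *-distribˡ-+ m x c ⟨
      m * (x + c)              ≡⟨ cong (m *_) eq ⟩
      m * (suc m * s)          ≡⟨ swap-product m s ⟨
      suc m * (m * s)          ≡⟨ cong (suc m *_) eq′ ⟨
      suc m * (x′ + c′)        ≡⟨ *-distribˡ-+ (suc m) x′ c′ ⟩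
      suc m * x′ + suc m * c′  ≤⟨ +-monoˡ-≤ (suc m * c′) le ⟩
      m * x + suc m * c′       ∎) ⟩
    c′ + m * c′     <⟨ +-monoˡ-< (m * c′) (<-≤-trans c′<c c≤m) ⟩
    m + m * c′      ≡⟨ *-suc m c′ ⟨
    m * suc c′      ≤⟨ *-monoʳ-≤ m c′<c ⟩
    m * c           ∎)
... | tri> _ _ s<s′ = contradiction (*-cancelˡ-≤ (suc m) (+-cancelˡ-≤ (m * x) _ _ (begin
    m * x + suc m * m              ≤⟨ +-monoˡ-≤ (suc m * m) (*-monoʳ-≤ m (m≤m+n x c)) ⟩
    m * (x + c) + suc m * m        ≡⟨ cong (λ y → m * y + suc m * m) eq ⟩
    m * (suc m * s) + suc m * m    ≡⟨ factor m s ⟩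
    suc m * (m * suc s)            ≤⟨ *-monoʳ-≤ (suc m) (*-monoʳ-≤ m s<s′) ⟩
    suc m * (m * s′)               ≡⟨ cong (suc m *_) eq′ ⟨
    suc m * (x′ + c′)              ≡⟨ *-distribˡ-+ (suc m) x′ c′ ⟩
    suc m * x′ + suc m * c′        ≤⟨ +-monoˡ-≤ (suc m * c′) le ⟩
    m * x + suc m * c′             ∎))) (<⇒≱ (c′<m s<s′))
  where
  open ≤-Reasoning
  factor : ∀ m s → m * (suc m * s) + suc m * m ≡ suc m * (m * suc s)
  factor = solve-∀

-- Division rounding up: `s` is the ceiling of `x / (m + 1)` and `c` the shortfall, in the shape of
-- `total+slack`.
division : ∀ m x → ∃[ s ] ∃[ c ] x + c ≡ suc m * s × c ≤ m
division m zero    = 0 , 0 , sym (*-zeroʳ m) , z≤n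
division m (suc x) with division m x
... | s , suc c , eq , c<m = s , c , trans (sym (+-suc x c)) eq , <⇒≤ c<m
... | s , zero  , eq , _   = suc s , m
  , trans (cong suc (trans (+-comm x m) (cong (λ y → m + y) (trans (sym (+-identityʳ x)) eq))))
          (sym (*-suc (suc m) s))
  , ≤-refl

division-unique : ∀ {m x c s c′ s′} → x + c ≡ suc m * s → x + c′ ≡ suc m * s′ →
  c ≤ m → c′ ≤ m → s ≡ s′ × c ≡ c′
division-unique {m} {x} {c} {s} {c′} {s′} eq eq′ c≤m c′≤m =
  s≡s′ , +-cancelˡ-≡ x c c′ (trans eq (trans (cong (suc m *_) s≡s′) (sym eq′)))
  where
  open ≤-Reasoning
  bound : ∀ {c s c′ s′} → x + c ≡ suc m * s → x + c′ ≡ suc m * s′ → c ≤ m → s ≤ s′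
  bound {c} {s} {c′} {s′} eq eq′ c≤m = s≤s⁻¹ (*-cancelˡ-< (suc m) s (suc s′) (begin-strict
    suc m * s          ≡⟨ eq ⟨
    x + c              <⟨ +-mono-≤-< (m≤m+n x c′) (s≤s c≤m) ⟩
    x + c′ + suc m     ≡⟨ cong (_+ suc m) eq′ ⟩
    suc m * s′ + suc m ≡⟨ trans (+-comm _ (suc m)) (sym (*-suc (suc m) s′)) ⟩
    suc m * suc s′     ∎))
  s≡s′ : s ≡ s′
  s≡s′ = ≤-antisym (bound eq eq′ c≤m) (bound eq′ eq c′≤m)

slack≤ : ∀ {m w v c s x} → Ascending (suc m) w → Run (suc m) w v c s x → c ≤ m
slack≤ {s = zero}  _ r rewrite proj₁ (none-selected r) = z≤n
slack≤ {s = suc _} a r = s≤s⁻¹ (slack<width a r)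

-- By `total+slack` the total fixes both the number of selections and the slack, so `run-unique`
-- applies.
run-determined : ∀ {m w w′ v v′ c c′ s s′ x x′} →
  Ascending (suc m) w → Ascending (suc m) w′ →
  Run (suc m) w v c s x → Run (suc m) w′ v′ c′ s′ x′ → v ≡ v′ → x ≡ x′ → w ≡ w′
run-determined {m} {s = s} {s′} a a′ r r′ refl refl
  with division-unique {m} {s = s} {s′ = s′}
         (total+slack r) (total+slack r′) (slack≤ a r) (slack≤ a′ r′)
... | refl , refl = run-unique a a′ r r′

-- The common interface of the two passages; it lets `rows` alternate between them in a single
-- induction.
record Descent (δ : ℕ → List ℕ → List ℕ) : Set where
  field
    ascending : ∀ {m w} → Ascending (suc m) w → Ascending m (δ m w)
    sound     : ∀ {m w} → Ascending (suc m) w →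
                suc m * total m (δ m w) ≤ m * total (suc m) w
    unique    : ∀ {m w w′} → Ascending (suc m) w → Ascending (suc m) w′ →
                total (suc m) w ≡ total (suc m) w′ → δ m w ≡ δ m w′ → w ≡ w′
    complete  : ∀ {m v x} → Ascending m v → suc m * total m v ≤ m * x →
                ∃[ w ] Ascending (suc m) w × δ m w ≡ v × total (suc m) w ≡ x

skipped-ascending : ∀ {m w v c s x} → Ascending (suc m) w →
  Run (suc m) w v c s x → Ascending m v
skipped-ascending []              []           = []
skipped-ascending (cons _ _ _ a)  (select _ r) = skipped-ascending a r
skipped-ascending (cons {e} 0<e _ e≤ a) (skip {c} r) = cons 0<e
  (≤-trans (m≤n+m e c) (s≤s⁻¹ (slack-bound e≤ r))) (run-all r e≤) (skipped-ascending a r)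

skipped-descent : Descent (λ m → skipped (suc m))
skipped-descent = record
  { ascending = asc
  ; sound     = λ a → let _ , r = run a; _ , r′ = run (asc a) in
      dominated⇒≤ (total+slack r) (total+slack r′) (slack≤ a r) (skipped-dominated a r r′)
  ; unique    = uniq
  ; complete  = comp
  }
  where
  asc : ∀ {m w} → Ascending (suc m) w → Ascending m (skipped (suc m) w)
  asc a = skipped-ascending a (proj₂ (run a))

  uniq : ∀ {m w w′} → Ascending (suc m) w → Ascending (suc m) w′ →
    total (suc m) w ≡ total (suc m) w′ → skipped (suc m) w ≡ skipped (suc m) w′ → w ≡ w′
  uniq a a′ x≡x′ v≡v′ =
    run-determined a a′ (proj₂ (run a)) (proj₂ (run a′)) v≡v′ x≡x′

  comp : ∀ {m v x} → Ascending m v → suc m * total m v ≤ m * x →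
    ∃[ w ] Ascending (suc m) w × skipped (suc m) w ≡ v × total (suc m) w ≡ x
  comp {m} {v} {x} a le with run a | division m x
  ... | s′ , r′ | s , c , eq , c≤m =
    let w , _ , a₁ , r = dominated⇒run a r′ c≤m
          (≤⇒dominated {s = s} {s′ = s′} eq (total+slack r′) c≤m
            -- The bound is only asked for when `s < s′`; then `s′` is positive and a selection has
            -- taken place.
            (λ { (s≤s _) → slack<width a r′ }) le)
    in w , a₁ , run-skipped r , +-cancelʳ-≡ c _ _
         (trans (cong (_+ c) (run-total r)) (trans (total+slack r) (sym eq)))

-- Lowering every entry by one

lower : List ℕ → List ℕ
lower []                = []
lower (suc (suc e) ∷ w) = suc e ∷ lower w
lower (_ ∷ w)           = lower w

lower-raise : ∀ {n w} → Ascending n w → ∀ j → lower (replicate j 1 ++ map suc w) ≡ w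
lower-raise a                       (suc j) = lower-raise a j
lower-raise []                      zero    = refl
lower-raise (cons {suc e} _ _ _ a)  zero    = cong (suc e ∷_) (lower-raise a zero)

-- In an ascending list the ones, which `lower` drops, stand in front; their number is all that gets
-- lost.
raise-lower : ∀ {n w} → Ascending n w → ∃[ j ] w ≡ replicate j 1 ++ map suc (lower w)
raise-lower [] = 0 , refl
raise-lower (cons {suc zero} _ _ _ a) with raise-lower a
... | j , eq = suc j , cong (1 ∷_) eq
raise-lower (cons {suc (suc e)} _ _ e≤ a) with raise-lower a
... | zero  , eq = zero , cong (suc (suc e) ∷_) eq
... | suc j , eq with s≤s () ∷ _ ← subst (All (suc (suc e) ≤_)) eq e≤

lower-ascending : ∀ {m w} → Ascending (suc m) w → Ascending m (lower w)
lower-ascending [] = []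
lower-ascending (cons {suc zero} _ _ _ a) = lower-ascending a
lower-ascending (cons {suc (suc e)} _ e≤n e≤ a) =
  cons z<s (s≤s⁻¹ e≤n) (lower-all e≤) (lower-ascending a)
  where
  lower-all : ∀ {w} → All (suc (suc e) ≤_) w → All (suc e ≤_) (lower w)
  lower-all []                             = []
  lower-all {w = suc (suc _) ∷ _} (p ∷ ps) = s≤s⁻¹ p ∷ lower-all ps
  lower-all {w = suc zero ∷ _} (s≤s () ∷ _)

raise-ascending : ∀ {m w} j → Ascending m w → Ascending (suc m) (replicate j 1 ++ map suc w)
raise-ascending zero    []                 = []
raise-ascending zero    (cons 0<e e≤m e≤ a) =
  cons z<s (s≤s e≤m) (map⁺ (All.map s≤s e≤)) (raise-ascending zero a)
raise-ascending (suc j) a =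
  cons z<s (s≤s z≤n) (ascending-all (λ 0<e _ → 0<e) (raise-ascending j a)) (raise-ascending j a)

-- Raising the entries and the width together preserves every slack, hence every choice; each
-- selected entry contributes one more.
run-map-suc : ∀ {n w v c s x} → Run n w v c s x →
  Run (suc n) (map suc w) (map suc v) c s (x + s)
run-map-suc [] = []
run-map-suc (select {c} {e} {s = s} {x} eq r) =
  subst (Run _ _ _ c (suc s)) (lemma e x s)
    (select (trans (+-suc c e) (cong suc eq)) (run-map-suc r))
  where
  lemma : ∀ e x s → suc e + (x + s) ≡ e + x + suc s
  lemma = solve-∀
run-map-suc (skip r) = skip (run-map-suc r)

-- An entry 1 adds one to the total whether it is selected or skipped.
run-ones : ∀ {n w v c s x} j → Run (suc n) w v c s x →
  ∃[ v′ ] ∃[ c′ ] ∃[ s′ ] Run (suc n) (replicate j 1 ++ w) v′ c′ s′ (j + x)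
run-ones zero    r = _ , _ , _ , r
run-ones {n} (suc j) r with run-ones j r
... | v , zero  , s , r′ = v , n , suc s , select (+-comm n 1) r′
... | v , suc c , s , r′ = 1 ∷ v , c , s , skip r′

total-raise : ∀ {n w v c s x} j → Run n w v c s x →
  total (suc n) (replicate j 1 ++ map suc w) ≡ j + (x + s)
total-raise j r = run-total (proj₂ (proj₂ (proj₂ (run-ones j (run-map-suc r)))))

lower-descent : Descent (λ _ → lower)
lower-descent = record
  { ascending = lower-ascending
  ; sound     = sound
  ; unique    = uniq
  ; complete  = comp
  }
  where
  total-lower : ∀ {m w v c s x} → ((j , _) : ∃[ j ] w ≡ replicate j 1 ++ map suc (lower w)) →
    Run m (lower w) v c s x → total (suc m) w ≡ j + (x + s)
  total-lower {m} (j , eq) r = trans (cong (total (suc m)) eq) (total-raise j r)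

  sound : ∀ {m w} → Ascending (suc m) w →
    suc m * total m (lower w) ≤ m * total (suc m) w
  sound {m} {w} a with run (lower-ascending a)
  ... | s , r = begin
    suc m * x             ≤⟨ +-monoˡ-≤ (m * x)
      (≤-trans (m≤m+n x (slack m (lower w))) (≤-reflexive (total+slack r))) ⟩
    m * s + m * x         ≡⟨ trans (+-comm (m * s) (m * x)) (sym (*-distribˡ-+ m x s)) ⟩
    m * (x + s)           ≤⟨ *-monoʳ-≤ m (m≤n+m (x + s) j) ⟩
    m * (j + (x + s))     ≡⟨ cong (m *_) (total-lower (raise-lower a) r) ⟨
    m * total (suc m) w   ∎
    where
    open ≤-Reasoning
    x = total m (lower w)
    j = proj₁ (raise-lower a)

  uniq : ∀ {m w w′} → Ascending (suc m) w → Ascending (suc m) w′ →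
    total (suc m) w ≡ total (suc m) w′ → lower w ≡ lower w′ → w ≡ w′
  uniq {m} {w} {w′} a a′ x≡x′ v≡v′
    with raise-lower a | raise-lower a′ | run (lower-ascending a)
  ... | j , eq | j′ , eq′ | s , r = trans eq (trans
    (cong₂ (λ i u → replicate i 1 ++ map suc u) j≡j′ v≡v′) (sym eq′))
    where
    j≡j′ : j ≡ j′
    j≡j′ = +-cancelʳ-≡ (total m (lower w) + s) j j′ (trans (sym (total-lower (j , eq) r))
      (trans x≡x′ (total-lower (j′ , eq′) (subst
        (λ u → Run m u (skipped m (lower w)) (slack m (lower w)) s (total m (lower w)))
        v≡v′ r))))

  comp : ∀ {m v x} → Ascending m v → suc m * total m v ≤ m * x →
    ∃[ w ] Ascending (suc m) w × lower w ≡ v × total (suc m) w ≡ x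
  comp {m} {v} {x} a le with run a
  ... | s , r = replicate j 1 ++ map suc v , raise-ascending j a , lower-raise a j
              , trans (total-raise j r) (m∸n+n≡m x₀+s≤x)
    where
    open ≤-Reasoning
    x₀ = total m v
    j  = x ∸ (x₀ + s)
    bound : ∀ {s} → Run m v (skipped m v) (slack m v) s x₀ → x₀ + s ≤ x
    bound {zero}  r rewrite proj₂ (none-selected r) = z≤n
    -- With `s + 1` selections, a slack below `m` means `m * s < x₀`, so `x ≤ x₀ + s` would
    -- contradict `le`.
    bound {suc s} r = ≮⇒≥ λ x<x₀+s → <-irrefl refl (begin-strict
      m * (x₀ + s)               ≡⟨ *-distribˡ-+ m x₀ s ⟩
      m * x₀ + m * s             <⟨ +-monoʳ-< (m * x₀) ms<x₀ ⟩
      m * x₀ + x₀                ≡⟨ +-comm (m * x₀) x₀ ⟩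
      suc m * x₀                 ≤⟨ le ⟩
      m * x                      ≤⟨ *-monoʳ-≤ m (s≤s⁻¹ (subst (x <_) (+-suc x₀ s) x<x₀+s)) ⟩
      m * (x₀ + s)               ∎)
      where
      ms<x₀ : m * s < x₀
      ms<x₀ = +-cancelˡ-< m _ _ (begin-strict
        m + m * s              ≡⟨ *-suc m s ⟨
        m * suc s              ≡⟨ total+slack r ⟨
        x₀ + slack m v         <⟨ +-monoʳ-< x₀ (slack<width a r) ⟩
        x₀ + m                 ≡⟨ +-comm x₀ m ⟩
        m + x₀                 ∎)
    x₀+s≤x : x₀ + s ≤ x
    x₀+s≤x = bound r

-- Rows of a lecture hall partition

leading : List ℕ → ℕ
leading []      = 0
leading (x ∷ _) = x

-- The ratio condition with denominators cleared. A missing next row counts as 0, and the width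
-- falling by one per row bounds the length.
data Hall : ℕ → List ℕ → Set where
  []   : ∀ {n} → Hall n []
  cons : ∀ {n x xs} → 0 < x → suc n * leading xs ≤ n * x → Hall n xs →
         Hall (suc n) (x ∷ xs)

infixr 5 _◂_

-- On Hall, a zero row can only be followed by zero rows, so dropping the tail
-- loses nothing.
_◂_ : ℕ → List ℕ → List ℕ
zero  ◂ _  = []
suc x ◂ xs = suc x ∷ xs

leading-◂ : ∀ x xs → leading (x ◂ xs) ≡ x
leading-◂ zero    _ = refl
leading-◂ (suc _) _ = refl

hall-◂ : ∀ {n} x {xs} → suc n * leading xs ≤ n * x → Hall n xs → Hall (suc n) (x ◂ xs)
hall-◂ zero    _  _ = []
hall-◂ (suc _) le h = cons z<s le h

below-zero : ∀ {n xs} → suc n * leading xs ≤ n * 0 → Hall n xs → xs ≡ []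
below-zero _  [] = refl
below-zero {n} le (cons {x = suc x} _ _ _) with () ← ≤-trans le (≤-reflexive (*-zeroʳ n))

-- The empty list is read as a zero row above the empty list, so that each positive width has a
-- first row to peel off.
uncons : ∀ {n xs} → Hall (suc n) xs →
  ∃[ x ] ∃[ ys ] xs ≡ x ◂ ys × suc n * leading ys ≤ n * x × Hall n ys
uncons {n} [] = 0 , [] , refl , ≤-reflexive (trans (*-zeroʳ (suc n)) (sym (*-zeroʳ n))) , []
uncons (cons {x = suc x} {xs} _ le h) = suc x , xs , refl , le , h

◂-injective : ∀ {n x y xs ys} → suc n * leading xs ≤ n * x → Hall n xs →
  suc n * leading ys ≤ n * y → Hall n ys → x ◂ xs ≡ y ◂ ys → x ≡ y × xs ≡ ys
◂-injective {x = zero}  {zero}  le h le′ h′ _ =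
  refl , trans (below-zero le h) (sym (below-zero le′ h′))
◂-injective {x = suc _} {suc _} _  _ _   _  refl =
  refl , refl

pad-◂-zero : ∀ x xs → pad (x ◂ xs) 0 ≡ + x
pad-◂-zero zero    _ = refl
pad-◂-zero (suc _) _ = refl

pad-◂-suc : ∀ {n} x {xs} → suc n * leading xs ≤ n * x → Hall n xs →
  ∀ j → pad (x ◂ xs) (suc j) ≡ pad xs j
pad-◂-suc zero    le h j rewrite below-zero le h = refl
pad-◂-suc (suc _) _  _ j = refl

δ : Bool → ℕ → List ℕ → List ℕ
δ true  _ = lower
δ false n = skipped (suc n)

descent : ∀ b → Descent (δ b)
descent true  = lower-descent
descent false = skipped-descent

-- Starting from `true`, two successive rows correspond to one passage of the insertion process from
-- width N to N - 2.
rows : Bool → ℕ → List ℕ → List ℕ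
rows _ zero    _ = []
rows b (suc n) w = total (suc n) w ◂ rows (not b) n (δ b n w)

leading-rows : ∀ b {n w} → Ascending n w → leading (rows b n w) ≡ total n w
leading-rows b {zero}  []  = refl
leading-rows b {zero}  (cons (s≤s _) () _ _)
leading-rows b {suc n} {w} a = leading-◂ (total (suc n) w) (rows (not b) n (δ b n w))

rows-sound : ∀ b {n w} → Ascending (suc n) w →
  suc n * leading (rows (not b) n (δ b n w)) ≤ n * total (suc n) w
rows-sound b {n} {w} a =
  subst (λ x → suc n * x ≤ n * total (suc n) w)
    (sym (leading-rows (not b) (Descent.ascending (descent b) a)))
    (Descent.sound (descent b) a)

rows-hall : ∀ b {n w} → Ascending n w → Hall n (rows b n w)
rows-hall b {zero}  _ = []
rows-hall b {suc n} {w} a =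
  hall-◂ (total (suc n) w) (rows-sound b a) (rows-hall (not b) (Descent.ascending (descent b) a))

rows-injective : ∀ b {n w w′} → Ascending n w → Ascending n w′ →
  rows b n w ≡ rows b n w′ → w ≡ w′
rows-injective b {zero} []  [] _ = refl
rows-injective b {zero} (cons (s≤s _) () _ _)
rows-injective b {zero} _ (cons (s≤s _) () _ _)
rows-injective b {suc n} a a′ eq =
  let d  = Descent.ascending (descent b) a
      d′ = Descent.ascending (descent b) a′
      x≡x′ , xs≡xs′ = ◂-injective (rows-sound b a) (rows-hall (not b) d)
                                  (rows-sound b a′) (rows-hall (not b) d′) eq
  in Descent.unique (descent b) a a′ x≡x′ (rows-injective (not b) d d′ xs≡xs′)

-- The list is rebuilt from the bottom row upwards, `complete` lifting it by one width at a time.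
rows-surjective : ∀ b {n xs} → Hall n xs → ∃[ w ] Ascending n w × rows b n w ≡ xs
rows-surjective b {zero} [] = [] , [] , refl
rows-surjective b {suc n} h =
  let x , ys , xs≡x◂ys , le , h′ = uncons h
      v , a , v↦ys = rows-surjective (not b) h′
      w , a′ , w↦v , total≡x = Descent.complete (descent b) a
        (subst (λ y → suc n * y ≤ n * x)
          (trans (cong leading (sym v↦ys)) (leading-rows (not b) a)) le)
  in w , a′ , trans (cong₂ _◂_ total≡x (trans (cong (rows (not b) n) w↦v) v↦ys)) (sym xs≡x◂ys)

-- Lecture hall partitions and odd partitions as lists

LH-≡ : ∀ {n} {μ ν : LH n} → parts (proj₁ μ) ≡ parts (proj₁ ν) → μ ≡ ν
LH-≡ {μ = partition _ d p , l , r} {partition _ d′ p′ , l′ , r′} refl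
  rewrite Linked.irrelevant ≤-irrelevant d d′ | All.irrelevant ≤-irrelevant p p′
        | ≤-irrelevant l l′ | Linked.irrelevant ℚᵘ.≤-irrelevant r r′ = refl

OP-≡ : ∀ {n} {μ ν : OP n} → parts (proj₁ μ) ≡ parts (proj₁ ν) → μ ≡ ν
OP-≡ {μ = partition _ d p , o} {partition _ d′ p′ , o′} refl
  rewrite Linked.irrelevant ≤-irrelevant d d′ | All.irrelevant ≤-irrelevant p p′
        | All.irrelevant (λ (e , l) (e′ , l′) →
            cong₂ _,_ (≡-irrelevant e e′) (≤-irrelevant l l′)) o o′ = refl

hall-positive : ∀ {n xs} → Hall n xs → All (_> 0) xs
hall-positive []             = []
hall-positive (cons 0<x _ h) = 0<x ∷ hall-positive h

hall-length : ∀ {n xs} → Hall n xs → length xs ≤ n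
hall-length []           = z≤n
hall-length (cons _ _ h) = s≤s (hall-length h)

hall-decreasing : ∀ {n xs} → Hall n xs → Linked _≥_ xs
hall-decreasing [] = []
hall-decreasing (cons _ _ []) = [-]
hall-decreasing (cons {suc n} {x} {y ∷ _} _ le h@(cons _ _ _)) =
  *-cancelˡ-≤ (suc n) (≤-trans (*-monoˡ-≤ y (n≤1+n (suc n))) le) ∷ hall-decreasing h

ratio-≥ : ∀ {n x y} → suc (suc n) * y ≤ suc n * x → (+ x ℚᵘ./ suc (suc n)) ℚᵘ.≥ (+ y ℚᵘ./ suc n)
ratio-≥ {n = n} {x} {y} le = *≤* (subst₂ ℤ._≤_ (ℤ.pos-* y (suc (suc n))) (ℤ.pos-* x (suc n))
  (ℤ.+≤+ (subst₂ _≤_ (*-comm (suc (suc n)) y) (*-comm (suc n) x) le)))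

ratio-≥⁻ : ∀ {n x y} → (+ x ℚᵘ./ suc (suc n)) ℚᵘ.≥ (+ y ℚᵘ./ suc n) → suc (suc n) * y ≤ suc n * x
ratio-≥⁻ {n} {x} {y} (*≤* le) = subst₂ _≤_ (*-comm y (suc (suc n))) (*-comm x (suc n))
  (ℤ.drop‿+≤+ (subst₂ ℤ._≤_ (sym (ℤ.pos-* y (suc (suc n)))) (sym (ℤ.pos-* x (suc n))) le))

hall-ratios : ∀ {n xs} → Hall n xs → Linked ℚᵘ._≥_ (ratios n xs)
hall-ratios {zero}  [] = []
hall-ratios {suc n} [] = []
hall-ratios (cons {zero} _ _ []) = [-]
hall-ratios (cons {suc n} _ _ []) = [-]
hall-ratios (cons _ le h@(cons {n} _ _ _)) = ratio-≥ {n} le ∷ hall-ratios h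

hall⇒LH : ∀ {n xs} → Hall n xs → LH n
hall⇒LH {xs = xs} h =
  partition xs (hall-decreasing h) (hall-positive h) , hall-length h , hall-ratios h

ratios⇒hall : ∀ {n} xs → All (_> 0) xs → length xs ≤ n → Linked ℚᵘ._≥_ (ratios n xs) → Hall n xs
ratios⇒hall [] _ _ _ = []
ratios⇒hall {suc n} (x ∷ []) (0<x ∷ _) _ _ =
  cons 0<x (subst (_≤ n * x) (sym (*-zeroʳ (suc n))) z≤n) []
ratios⇒hall {suc (suc n)} (x ∷ y ∷ xs) (0<x ∷ pos) (s≤s len) (x≥y ∷ rs) =
  cons 0<x (ratio-≥⁻ {n} x≥y) (ratios⇒hall (y ∷ xs) pos len rs)

LH⇒hall : ∀ {n} (μ : LH n) → Hall n (parts (proj₁ μ))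
LH⇒hall (partition xs _ pos , len , rs) = ratios⇒hall xs pos len rs

-- The k-th odd number 2k-1, with odd 0 = 0.
odd : ℕ → ℕ
odd zero            = 0
odd (suc zero)      = 1
odd (suc (suc k))   = suc (suc (odd (suc k)))

⌈odd/2⌉ : ∀ k → ⌈ odd k /2⌉ ≡ k
⌈odd/2⌉ zero          = refl
⌈odd/2⌉ (suc zero)    = refl
⌈odd/2⌉ (suc (suc k)) = cong suc (⌈odd/2⌉ (suc k))

odd-⌈/2⌉ : ∀ p → p % 2 ≡ 1 → odd ⌈ p /2⌉ ≡ p
odd-⌈/2⌉ (suc zero)          _  = refl
odd-⌈/2⌉ (suc (suc (suc p))) eq = cong (λ m → suc (suc m)) (odd-⌈/2⌉ (suc p) eq)

odd-% : ∀ k → 0 < k → odd k % 2 ≡ 1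
odd-% (suc zero)    _ = refl
odd-% (suc (suc k)) _ = odd-% (suc k) z<s

odd>0 : ∀ k → 0 < k → odd k > 0
odd>0 (suc zero)    _ = z<s
odd>0 (suc (suc k)) _ = z<s

odd≤ : ∀ k → odd k ≤ 2 * k
odd≤ zero          = z≤n
odd≤ (suc zero)    = s≤s z≤n
odd≤ (suc (suc k)) = subst (odd (2 + k) ≤_) (sym (*-suc 2 (suc k))) (s≤s (s≤s (odd≤ (suc k))))

odd-mono : ∀ {k l} → k ≤ l → odd k ≤ odd l
odd-mono {zero} _ = z≤n
odd-mono {suc zero} {suc zero}    _ = ≤-refl
odd-mono {suc zero} {suc (suc _)} _ = s≤s z≤n
odd-mono {suc (suc k)} {suc (suc l)} (s≤s le) = s≤s (s≤s (odd-mono le))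

-- Reversed, so that the largest part, which is inserted first, lies at the far end, where a right
-- fold begins.
indices : List ℕ → List ℕ
indices ps = reverse (map ⌈_/2⌉ ps)

indices-ascending : ∀ {n} (λ′ : OP n) → Ascending n (indices (parts (proj₁ λ′)))
indices-ascending {n} (partition ps dec pos , odds) = go ps dec pos odds
  where
  prepend : ∀ {q w} ps → Linked _≥_ (q ∷ ps) → All (_> 0) ps →
    All (λ p → p % 2 ≡ 1 × p ≤ 2 * n) ps → All (⌈ q /2⌉ ≤_) w → Ascending n w →
    Ascending n (map ⌈_/2⌉ ps ʳ++ w)
  prepend [] _ _ _ _ a = a
  prepend {q} {w} (p ∷ ps) (q≥p ∷ dec) (0<p ∷ pos) ((_ , p≤2n) ∷ odds) q≤w a =
    prepend ps dec pos odds (≤-refl ∷ p≤w) (cons (⌈n/2⌉-mono 0<p)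
      (≤-trans (⌈n/2⌉-mono p≤2n) (≤-reflexive ⌈2n/2⌉≡n)) p≤w a)
    where
    p≤w : All (⌈ p /2⌉ ≤_) w
    p≤w = All.map (≤-trans (⌈n/2⌉-mono q≥p)) q≤w
    ⌈2n/2⌉≡n : ⌈ 2 * n /2⌉ ≡ n
    ⌈2n/2⌉≡n = trans (cong (λ m → ⌈ n + m /2⌉) (+-identityʳ n)) (sym (n≡⌈n+n/2⌉ n))
  go : ∀ ps → Linked _≥_ ps → All (_> 0) ps →
    All (λ p → p % 2 ≡ 1 × p ≤ 2 * n) ps → Ascending n (indices ps)
  go []       _   _   _    = []
  -- The largest part serves as its own predecessor, the accumulator still being empty.
  go (p ∷ ps) dec pos odds = prepend (p ∷ ps) (≤-refl ∷ dec) pos odds [] []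

indices-injective : ∀ {n} {λ′ μ : OP n} →
  indices (parts (proj₁ λ′)) ≡ indices (parts (proj₁ μ)) → λ′ ≡ μ
indices-injective {n} {λ′ = λ′} {μ} eq =
  OP-≡ {n} {λ′} {μ} (go (proj₂ λ′) (proj₂ μ) (reverse-injective eq))
  where
  go : ∀ {ps qs} → All (λ p → p % 2 ≡ 1 × p ≤ 2 * n) ps →
    All (λ p → p % 2 ≡ 1 × p ≤ 2 * n) qs → map ⌈_/2⌉ ps ≡ map ⌈_/2⌉ qs → ps ≡ qs
  go [] [] _ = refl
  go (_∷_ {p} (p-odd , _) ps) (_∷_ {q} (q-odd , _) qs) eq = cong₂ _∷_
    (trans (sym (odd-⌈/2⌉ p p-odd)) (trans (cong odd (∷-injectiveˡ eq)) (odd-⌈/2⌉ q q-odd)))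
    (go ps qs (∷-injectiveʳ eq))

all-ʳ++ : ∀ {P : ℕ → Set} {xs ys} → All P xs → All P ys → All P (xs ʳ++ ys)
all-ʳ++ []       qs = qs
all-ʳ++ (p ∷ ps) qs = all-ʳ++ ps (p ∷ qs)

decreasing-ʳ++ : ∀ {n w e ps} → Ascending n w → All (e ≤_) w → Linked _≥_ (odd e ∷ ps) →
  Linked _≥_ (map odd w ʳ++ (odd e ∷ ps))
decreasing-ʳ++ []             _           dec = dec
decreasing-ʳ++ (cons _ _ f≤ a) (e≤f ∷ _)  dec = decreasing-ʳ++ a f≤ (odd-mono e≤f ∷ dec)

indices-surjective : ∀ {n w} → Ascending n w →
  ∃[ λ′ ] indices (parts (proj₁ {B = IsOddPartition n} λ′)) ≡ w
indices-surjective {n} {w} a =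
  ( partition (reverse (map odd w)) (dec a)
      (all-ʳ++ (map⁺ (ascending-all (λ {e} 0<e _ → odd>0 e 0<e) a)) [])
  , all-ʳ++ (map⁺ (ascending-all (λ {e} 0<e e≤n →
      odd-% e 0<e , ≤-trans (odd≤ e) (*-monoʳ-≤ 2 e≤n)) a)) [] )
  , (begin
      reverse (map ⌈_/2⌉ (reverse (map odd w)))    ≡⟨ cong reverse (reverse-map ⌈_/2⌉ (map odd w)) ⟩
      reverse (reverse (map ⌈_/2⌉ (map odd w)))    ≡⟨ reverse-involutive _ ⟩
      map ⌈_/2⌉ (map odd w)                        ≡⟨ map-∘ w ⟨
      map (λ k → ⌈ odd k /2⌉) w                    ≡⟨ map-id-local (All.universal ⌈odd/2⌉ w) ⟩
      w                                            ∎)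
  where
  open ≡-Reasoning
  dec : ∀ {w} → Ascending n w → Linked _≥_ (reverse (map odd w))
  dec []              = []
  dec (cons _ _ e≤ a) = decreasing-ʳ++ a e≤ [-]

-- The sequences A and the map Φ

-- Raising `n` by two and `k` by one keeps the truth value of `2 * k ≤ n` and lengthens the list by
-- two.
trapezoid-step : ∀ {n k} → k ≤ n →
  trapezoid (2+ n) (2+ k) ≡ 2+ n ∷ suc n ∷ trapezoid n (suc k)
trapezoid-step {n} {k} k≤n with 2 * 2+ k ≤? 2+ n | 2 * suc k ≤? n
... | yes _ | yes _ = cong (applyUpTo (2+ n ∸_)) (cong suc (+-suc k (suc (k + 0))))
... | no _  | no _  = cong (applyUpTo (2+ n ∸_)) (begin
  2 * suc (2+ n) ∸ 2 * 2+ k          ≡⟨ cong₂ _∸_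
    (trans (*-suc 2 (2+ n)) (cong 2+ (*-suc 2 (suc n)))) (*-suc 2 (suc k)) ⟩
  2+ (2 * suc n) ∸ 2 * suc k         ≡⟨ +-∸-assoc 2 (*-monoʳ-≤ 2 (s≤s k≤n)) ⟩
  2+ (2 * suc n ∸ 2 * suc k)         ∎)
  where open ≡-Reasoning
... | yes p | no ¬p = contradiction (s≤s⁻¹ (s≤s⁻¹ (subst (_≤ 2+ n) (*-suc 2 (suc k)) p))) ¬p
... | no ¬p | yes p = contradiction (subst (_≤ 2+ n) (sym (*-suc 2 (suc k))) (s≤s (s≤s p))) ¬p

A-suc : ∀ i k → A (suc i) (suc k) ≡
  pad (trapezoid (suc (k + i)) (suc k)) ⊖ pad (trapezoid (k + i) (suc k))
A-suc i k = cong (λ n → pad (trapezoid n (suc k)) ⊖ pad (trapezoid (n ∸ 1) (suc k))) (+-suc k i)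

trapezoid-0 : ∀ k → trapezoid k (suc k) ≡ []
trapezoid-0 k with 2 * suc k ≤? k
... | yes p = contradiction (≤-trans (m≤m+n (suc k) (suc k + 0)) p) (<-irrefl refl)
... | no _  = cong (applyUpTo (k ∸_)) (n∸n≡0 (2 * suc k))

trapezoid-1 : ∀ k → trapezoid (suc k) (suc k) ≡ suc k ∷ k ∷ []
trapezoid-1 zero    = refl
trapezoid-1 (suc k) with 2 * 2+ k ≤? 2+ k
... | yes p = contradiction
  (subst (_≤ 2+ k) (+-suc (2+ k) (suc k + 0)) p) (<⇒≱ (s≤s (m≤m+n (2+ k) _)))
... | no _  = cong (applyUpTo (2+ k ∸_)) (trans
  (cong (_∸ 2 * 2+ k) (*-suc 2 (2+ k))) (m+n∸n≡m 2 (2 * 2+ k)))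

A-first : ∀ k → A 1 (suc k) ≗ pad (suc k ∷ k ∷ [])
A-first k j = trans (cong-app A≡ j) (ℤ.+-identityʳ (pad (suc k ∷ k ∷ []) j))
  where
  A≡ : A 1 (suc k) ≡ pad (suc k ∷ k ∷ []) ⊖ pad []
  A≡ = trans (A-suc 0 k) (trans
    (cong (λ n → pad (trapezoid (suc n) (suc k)) ⊖ pad (trapezoid n (suc k))) (+-identityʳ k))
    (cong₂ (λ t u → pad t ⊖ pad u) (trapezoid-1 k) (trapezoid-0 k)))

suc-minus : ∀ n → + suc n ℤ.- + n ≡ + 1
suc-minus n = trans (ℤ.m-n≡m⊖n (suc n) n) (trans (ℤ.⊖-≥ (n≤1+n n)) (cong +_ (m+n∸n≡m 1 n)))

-- For `k = 1` each of the two trapezoids is a single entry up to a trailing zero, and these entries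
-- differ by one.
A-1 : ∀ i → A (2+ i) 1 ≗ pad (1 ∷ [])
A-1 zero    zero          = refl
A-1 zero    (suc zero)    = refl
A-1 zero    (suc (suc j)) = refl
A-1 (suc i) zero          = suc-minus (2+ i)
A-1 (suc i) (suc j)       = refl

-- `trapezoid-step` strips two entries from both trapezoids. The stripped entries differ by one,
-- which yields the leading (1, 1).
A-2+ : ∀ i k → A (2+ i) (2+ k) ≡
  pad (3 + (k + i) ∷ 2+ (k + i) ∷ trapezoid (suc (k + i)) (suc k)) ⊖
  pad (2+ (k + i) ∷ suc (k + i) ∷ trapezoid (k + i) (suc k))
A-2+ i k = trans (A-suc (suc i) (suc k)) (trans
  (cong (λ n → pad (trapezoid (2+ n) (2+ k)) ⊖ pad (trapezoid (suc n) (2+ k))) (+-suc k i))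
  (cong₂ (λ t u → pad t ⊖ pad u)
    (trapezoid-step (m≤n⇒m≤1+n (m≤m+n k i))) (trapezoid-step (m≤m+n k i))))

A-2+-zero : ∀ i k → A (2+ i) (2+ k) 0 ≡ + 1
A-2+-zero i k = trans (cong-app (A-2+ i k) 0) (suc-minus (2+ (k + i)))

A-2+-one : ∀ i k → A (2+ i) (2+ k) 1 ≡ + 1
A-2+-one i k = trans (cong-app (A-2+ i k) 1) (suc-minus (suc (k + i)))

A-2+-rest : ∀ i k j → A (2+ i) (2+ k) (2+ j) ≡ A (suc i) (suc k) j
A-2+-rest i k j = trans (cong-app (A-2+ i k) (2+ j)) (sym (cong-app (A-suc i k) j))

-- Splitting two rows off the insertion process

insertIndex : ∀ {m} → ℕ → ℕ → Seq × Vec ℕ m → Seq × Vec ℕ m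
insertIndex n k S =
  proj₁ S ⊕ A (firstZero (proj₂ S)) k ,
  advance (suc n ∸ (k + firstZero (proj₂ S))) (proj₂ S)

-- The counter has m entries rather than n: removing its first entry goes
-- together with lowering n by two.
process : ℕ → (m : ℕ) → List ℕ → Seq × Vec ℕ m
process n m = foldr (insertIndex n) (pad [] , Vec.replicate m 0)

Φ-process : ∀ n (λ′ : OP n) → Φ n λ′ ≡ proj₁ (process n n (indices (parts (proj₁ λ′))))
Φ-process n (λ′ , _) = cong proj₁ (trans (insert-indices _ (parts λ′))
  (sym (reverse-foldr (insertIndex n) _ (map ⌈_/2⌉ (parts λ′)))))
  where
  insert-indices : ∀ (S : Seq × Vec ℕ n) ps →
    foldl insert S ps ≡ foldl (λ S k → insertIndex n k S) S (map ⌈_/2⌉ ps)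
  insert-indices S       []       = refl
  insert-indices (s , I) (p ∷ ps) = insert-indices (insert (s , I) p) ps

firstZero-suc : ∀ {m} (I : Vec ℕ m) → ∃[ i ] firstZero I ≡ suc i
firstZero-suc []          = 0 , refl
firstZero-suc (zero  ∷ _) = 0 , refl
firstZero-suc (suc _ ∷ I) = firstZero I , refl

-- The inner counter is matched only while no part is 1.  Afterwards every
-- further part is 1, and A i 1 affects the first row only, whatever i is.
record Peels (n m : ℕ) (w : List ℕ) (S : Seq × Vec ℕ (suc m)) : Set where
  private
    inner = process n m (skipped (suc n) (lower w))
  field
    first   : proj₁ S 0 ≡ + total (2+ n) w
    second  : proj₁ S 1 ≡ + total (suc n) (lower w)
    rest    : ∀ j → proj₁ S (2+ j) ≡ proj₁ inner j
    counter : head (proj₂ S) ≡ slack (2+ n) w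
    inside  : All (2 ≤_) w →
              tail (proj₂ S) ≡ proj₂ inner × slack (suc n) (lower w) ≡ slack (2+ n) w

on-select : ∀ n w e → slack n w ≡ 0 → slack n (e ∷ w) ≡ n ∸ e ×
  skipped n (e ∷ w) ≡ skipped n w × total n (e ∷ w) ≡ e + total n w
on-select _ _ _ eq rewrite eq = refl , refl , refl

on-skip : ∀ n w e {c} → slack n w ≡ suc c → slack n (e ∷ w) ≡ c ×
  skipped n (e ∷ w) ≡ e ∷ skipped n w × total n (e ∷ w) ≡ suc (total n w)
on-skip _ _ _ eq rewrite eq = refl , refl , refl

+-pos : ∀ {a b x y z} → a ≡ + x → b ≡ + y → z ≡ y + x → a ℤ.+ b ≡ + z
+-pos {x = x} {y} refl refl refl = cong +_ (+-comm x y)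

+-zero : ∀ {a b c} → a ≡ c → b ≡ + 0 → a ℤ.+ b ≡ c
+-zero {a} refl refl = ℤ.+-identityʳ a

-- A zero head of the counter means selection with `i = 1`. For a skipped `k ≥ 2` the first zero
-- lies one place later than in the inner counter, and the update is (1, 1) followed by the inner
-- insertion of `k - 1`. An entry 1 vanishes under `lower` and changes the first row only.
peels-∷ : ∀ {n m k w} S → 0 < k → All (k ≤_) w → Peels n m w S →
  Peels n m (k ∷ w) (insertIndex (2+ n) k S)
peels-∷ {n} {k = suc zero} {w} (s , zero ∷ I) _ _ p
  with on-select (2+ n) w 1 (sym (Peels.counter p))
... | slack≡ , _ , total≡ = record
  { first   = +-pos (Peels.first p) (A-first 0 0) total≡
  ; second  = +-zero (Peels.second p) (A-first 0 1)
  ; rest    = λ j → +-zero (Peels.rest p j) (A-first 0 (2+ j))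
  ; counter = sym slack≡
  ; inside  = λ { (s≤s () ∷ _) }
  }
peels-∷ {n} {k = suc zero} {w} (s , suc c ∷ I) _ _ p
  with firstZero I | firstZero-suc I | on-skip (2+ n) w 1 (sym (Peels.counter p))
... | _ | i , refl | slack≡ , _ , total≡ = record
  { first   = +-pos (Peels.first p) (A-1 i 0) total≡
  ; second  = +-zero (Peels.second p) (A-1 i 1)
  ; rest    = λ j → +-zero (Peels.rest p j) (A-1 i (2+ j))
  ; counter = sym slack≡
  ; inside  = λ { (s≤s () ∷ _) }
  }
peels-∷ {n} {m} {2+ k} {w} (s , zero ∷ I) _ k≤ p
  with Peels.inside p (All.map (≤-trans (s≤s (s≤s z≤n))) k≤)
... | tail≡ , inner-slack
  with on-select (2+ n) w (2+ k) (sym (Peels.counter p))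
     | on-select (suc n) (lower w) (suc k) (trans inner-slack (sym (Peels.counter p)))
... | slack≡ , _ , total≡ | slack′≡ , skipped′≡ , total′≡ = record
  { first   = +-pos (Peels.first p) (A-first (suc k) 0) total≡
  ; second  = +-pos (Peels.second p) (A-first (suc k) 1) total′≡
  ; rest    = λ j → trans (+-zero (Peels.rest p j) (A-first (suc k) (2+ j)))
                (cong (λ v → proj₁ (process n m v) j) (sym skipped′≡))
  ; counter = trans (cong (suc n ∸_) (+-comm k 1)) (sym slack≡)
  ; inside  = λ _ → trans tail≡ (cong (λ v → proj₂ (process n m v)) (sym skipped′≡))
                  , trans slack′≡ (sym slack≡)
  }
peels-∷ {n} {m} {2+ k} {w} (s , suc c ∷ I) _ k≤ p
  with Peels.inside p (All.map (≤-trans (s≤s (s≤s z≤n))) k≤)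
... | refl , inner-slack
  with on-skip (2+ n) w (2+ k) (sym (Peels.counter p))
     | on-skip (suc n) (lower w) (suc k) (trans inner-slack (sym (Peels.counter p)))
... | slack≡ , _ , total≡ | slack′≡ , skipped′≡ , total′≡ = record
  { first   = +-pos (Peels.first p) (trans (A≡ 0) (A-2+-zero i k)) total≡
  ; second  = +-pos (Peels.second p) (trans (A≡ 1) (A-2+-one i k)) total′≡
  ; rest    = λ j → trans (cong₂ ℤ._+_ (Peels.rest p j)
                (trans (A≡ (2+ j)) (trans (A-2+-rest i k j)
                  (cong (λ z → A z (suc k) j) (sym fz≡)))))
                (cong (λ v → proj₁ (process n m v) j) (sym skipped′≡))
  ; counter = sym slack≡
  -- Both insertions write the same value N - k - i + 1: inside, N is smaller by two and k and i by
  -- one each.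
  ; inside  = λ _ → trans (cong (λ v → advance v I) (cong (suc n ∸_) (+-suc k (firstZero I))))
                     (cong (λ v → proj₂ (process n m v)) (sym skipped′≡))
                  , trans slack′≡ (sym slack≡)
  }
  where
  i = proj₁ (firstZero-suc I)
  fz≡ : firstZero I ≡ suc i
  fz≡ = proj₂ (firstZero-suc I)
  A≡ : ∀ j → A (suc (firstZero I)) (2+ k) j ≡ A (2+ i) (2+ k) j
  A≡ j = cong (λ z → A (suc z) (2+ k) j) fz≡

process-peels : ∀ {n m w} → Ascending (2+ n) w → Peels n m w (process (2+ n) (suc m) w)
process-peels []                = record
  { first = refl ; second = refl ; rest = λ _ → refl ; counter = refl ; inside = λ _ → refl , refl }
process-peels (cons 0<k _ k≤ a) = peels-∷ _ 0<k k≤ (process-peels a)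

-- Every entry is 1, and selecting it leaves slack 0, so nothing is ever skipped.
process-1 : ∀ {m w} → Ascending 1 w →
  (proj₁ (process 1 (suc m) w) ≗ pad (total 1 w ∷ [])) ×
  head (proj₂ (process 1 (suc m) w)) ≡ 0 × slack 1 w ≡ 0
process-1 [] = (λ { zero → refl ; (suc _) → refl }) , refl , refl
process-1 {m} (cons {suc zero} {w} _ _ _ a) with process 1 (suc m) w | process-1 {m} a
... | s , zero ∷ I | s≡ , refl , slack≡0 with on-select 1 w 1 slack≡0
...   | slack≡ , _ , total≡ =
  (λ { zero          → +-pos (s≡ 0) (A-first 0 0) total≡
     ; (suc zero)    → +-zero (s≡ 1) (A-first 0 1)
     ; (suc (suc j)) → +-zero (s≡ (2+ j)) (A-first 0 (2+ j)) })
  , refl , slack≡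
process-1 (cons {suc (suc _)} _ (s≤s ()) _ _)

-- Induction in steps of two on the width. Each step uses up one counter entry, and `n ≤ m`
-- guarantees that one is available.
process-rows : ∀ {n m w} → n ≤ m → Ascending n w →
  proj₁ (process n m w) ≗ pad (rows true n w)
process-rows {zero} _ [] j = refl
process-rows {zero} _ (cons (s≤s _) () _ _)
process-rows {suc zero} {suc m} {w} _ a zero =
  trans (proj₁ (process-1 a) 0) (sym (pad-◂-zero (total 1 w) []))
process-rows {suc zero} {suc m} {w} _ a (suc j) =
  trans (proj₁ (process-1 a) (suc j)) (sym (pad-◂-suc {n = 0} (total 1 w) z≤n [] j))
process-rows {2+ n} {suc m} {w} (s≤s n<m) a = go
  where
  open Peels (process-peels {n} {m} a)
  a₁ = lower-ascending a
  a₂ = Descent.ascending skipped-descent a₁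
  below = pad-◂-suc (total (2+ n) w) (rows-sound true a) (rows-hall false a₁)
  go : proj₁ (process (2+ n) (suc m) w) ≗ pad (rows true (2+ n) w)
  go zero          = trans first (sym (pad-◂-zero (total (2+ n) w) _))
  go (suc zero)    = trans second (sym (trans (below 0) (pad-◂-zero (total (suc n) (lower w)) _)))
  go (suc (suc j)) = trans (rest j) (trans (process-rows (<⇒≤ n<m) a₂ j) (sym (trans (below (suc j))
    (pad-◂-suc (total (suc n) (lower w)) (rows-sound false a₁) (rows-hall true a₂) j))))

mainTheorem5 : (N : ℕ) .{{_ : NonZero N}} →
    Σ[ φ ∈ (OP N ⤖ LH N) ]
    (∀ (λ′ : OP N) → pad (parts (proj₁ (Bijection.to φ λ′))) ≗ Φ N λ′)
-- The bijection is built from `rows`; `process-rows`, with as many counter entries as the width,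
-- identifies it with `Φ`.
mainTheorem5 N = mk⤖ {to = to} (injective , surjective) , λ λ′ j →
  sym (trans (cong-app (Φ-process N λ′) j) (process-rows ≤-refl (indices-ascending {N} λ′) j))
  where
  to : OP N → LH N
  to λ′ = hall⇒LH (rows-hall true (indices-ascending {N} λ′))

  injective : ∀ {λ′ μ} → to λ′ ≡ to μ → λ′ ≡ μ
  injective {λ′} {μ} eq = indices-injective {N} {λ′} {μ} (rows-injective true
    (indices-ascending {N} λ′) (indices-ascending {N} μ) (cong (λ ν → parts (proj₁ ν)) eq))

  surjective : ∀ ν → ∃[ λ′ ] (∀ {μ} → μ ≡ λ′ → to μ ≡ ν)
  surjective ν =
    let w , a , rows≡ = rows-surjective true (LH⇒hall {N} ν)
        λ′ , indices≡ = indices-surjective a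
    in λ′ , λ { refl → LH-≡ {N} (trans (cong (rows true N) indices≡) rows≡) }
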